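{- For all positive integers $b_1,\dots,b_k$, $$\operatorname{op}_{[b_1,\dots,b_k]}(123)=\operatorname{op}_{[b_1,\dots,b_k]}(132).$$
   Context: An ordered set partition of $[N]$ into $k$ blocks is a sequence $B_1/B_2/\cdots/B_k$ of nonempty, pairwise disjoint subsets of $[N]$ whose union is $[N]$; the order of the blocks matters, but not the order of elements within a block. For a permutation $\rho=\rho_1\cdots\rho_m\in\mathcal{S}_m$, an ordered partition $B_1/\cdots/B_k$ contains $\rho$ if there are block indices $i_1<i_2<\cdots<i_m$ and elements $b_j\in B_{i_j}$ such that $b_1\cdots b_m$ is order-isomorphic to $\rho$ (i.e. $b_a<b_c$ iff $\rho_a<\rho_c$); otherwise it avoids $\rho$. For positive integers $b_1,\dots,b_k$, $\operatorname{op}_{[b_1,\dots,b_k]}(\rho)$ is the number of $\rho$-avoiding ordered partitions $B_1/\cdots/B_k$ of $[b_1+\cdots+b_k]$ with $|B_i|=b_i$ for all $i$. -}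

module Defs where

open import Data.Bool.Base using (true; false)
open import Data.Fin.Base using (Fin; _<_)
open import Data.Fin.Patterns using (0F; 1F; 2F)
open import Data.Fin.Permutation using (Permutation′; permutation; _⟨$⟩ʳ_)
open import Data.Fin.Properties using (_≟_; _<?_; all?; any?)
open import Data.Fin.Subset using (Subset; _∈_; _∩_; ∣_∣; Nonempty; Empty)
open import Data.Fin.Subset.Properties using (_∈?_; nonempty?)
open import Data.List.Base as List using (List; cartesianProductWith; filter; length)
open import Data.List.Membership.Propositional as List using ()
open import Data.List.Membership.Propositional.Properties using (∈-cartesianProductWith⁺)
open import Data.List.Relation.Unary.All as ListAll using ()
open import Data.List.Relation.Unary.AllPairs as AllPairs using ()
open import Data.List.Relation.Unary.Any using (here; there)
open import Data.List.Relation.Unary.Unique.Propositional using (Unique)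
open import Data.List.Relation.Unary.Unique.Propositional.Properties using (cartesianProductWith⁺)
open import Data.Nat.Base using (ℕ; zero; suc)
import Data.Nat.Properties as ℕ
open import Data.Product.Base using (∃; ∃-syntax; _×_; _,_)
open import Data.Vec.Base using (Vec; []; _∷_; lookup; sum)
open import Data.Vec.Properties using (∷-injective)
open import Function.Bundles using (_⇔_; mk⇔; Equivalence)
open import Relation.Binary.PropositionalEquality using (_≡_; _≢_; refl)
open import Relation.Nullary using (¬_; Dec; ¬?; _×-dec_; _→-dec_)
open import Relation.Nullary.Decidable using (map′)
open import Relation.Unary using (Decidable)

private
  variable
    k m n N : ℕ

-- The elements 1 < ⋯ < N of [N] are represented by the elements of Fin N,
-- in the same order.

IsOrderedPartition : Vec (Subset N) k → Set
IsOrderedPartition {N} {k} B =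
  (∀ (i : Fin k) → Nonempty (lookup B i)) ×
  (∀ (i j : Fin k) → i ≢ j → Empty (lookup B i ∩ lookup B j)) ×
  (∀ (x : Fin N) → ∃[ i ] x ∈ lookup B i)

HasBlockSizes : Vec ℕ k → Vec (Subset N) k → Set
HasBlockSizes {k} b B = ∀ (i : Fin k) → ∣ lookup B i ∣ ≡ lookup b i

StrictlyIncreasing : Vec (Fin n) m → Set
StrictlyIncreasing {m = m} i =
  ∀ (a c : Fin m) → a < c → lookup i a < lookup i c

OrderIsomorphic : Vec (Fin n) m → Permutation′ m → Set
OrderIsomorphic {m = m} x ρ =
  ∀ (a c : Fin m) → (lookup x a < lookup x c) ⇔ ((ρ ⟨$⟩ʳ a) < (ρ ⟨$⟩ʳ c))

Contains : Permutation′ m → Vec (Subset N) k → Set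
Contains {m} {N} {k} ρ B =
  ∃[ i ] StrictlyIncreasing {k} {m} i ×
    (∃[ x ] (∀ (j : Fin m) → lookup x j ∈ lookup B (lookup i j)) ×
            OrderIsomorphic {N} x ρ)

Avoids : Permutation′ m → Vec (Subset N) k → Set
Avoids ρ B = ¬ Contains ρ B

Avoider : Vec ℕ k → Permutation′ m → Vec (Subset N) k → Set
Avoider b ρ B = IsOrderedPartition B × HasBlockSizes b B × Avoids ρ B

∃Vec? : ∀ m {P : Vec (Fin n) m → Set} → Decidable P → Dec (∃ P)
∃Vec? zero    P? = map′ (λ p → [] , p) (λ { ([] , p) → p }) (P? [])
∃Vec? (suc m) P? =
  map′ (λ { (x , xs , p) → x ∷ xs , p }) (λ { (x ∷ xs , p) → x , xs , p })
       (any? λ x → ∃Vec? m λ xs → P? (x ∷ xs))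

_⇔?_ : ∀ {A B : Set} → Dec A → Dec B → Dec (A ⇔ B)
a? ⇔? b? =
  map′ (λ { (f , g) → mk⇔ f g }) (λ e → Equivalence.to e , Equivalence.from e)
       ((a? →-dec b?) ×-dec (b? →-dec a?))

isOrderedPartition? : Decidable (IsOrderedPartition {N} {k})
isOrderedPartition? B =
  all? (λ i → nonempty? (lookup B i)) ×-dec
  all? (λ i → all? λ j → ¬? (i ≟ j) →-dec ¬? (nonempty? (lookup B i ∩ lookup B j))) ×-dec
  all? (λ x → any? λ i → x ∈? lookup B i)

hasBlockSizes? : (b : Vec ℕ k) → Decidable (HasBlockSizes {k} {N} b)
hasBlockSizes? b B = all? λ i → ∣ lookup B i ∣ ℕ.≟ lookup b i

contains? : (ρ : Permutation′ m) → Decidable (Contains {m} {N} {k} ρ)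
contains? {m} ρ B =
  ∃Vec? m λ i →
    all? (λ a → all? λ c → (a <? c) →-dec (lookup i a <? lookup i c)) ×-dec
    ∃Vec? m λ x →
      all? (λ j → lookup x j ∈? lookup B (lookup i j)) ×-dec
      all? (λ a → all? λ c →
        (lookup x a <? lookup x c) ⇔? ((ρ ⟨$⟩ʳ a) <? (ρ ⟨$⟩ʳ c)))

avoider? : (b : Vec ℕ k) (ρ : Permutation′ m) → Decidable (Avoider {N = N} b ρ)
avoider? b ρ B =
  isOrderedPartition? B ×-dec hasBlockSizes? b B ×-dec ¬? (contains? ρ B)

vectors : ∀ {A : Set} → List A → ∀ n → List (Vec A n)
vectors xs zero    = List.[ [] ]
vectors xs (suc n) = cartesianProductWith _∷_ xs (vectors xs n)

subsets : ∀ N → List (Subset N)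
subsets = vectors (true List.∷ false List.∷ List.[])

blockSequences : ∀ N k → List (Vec (Subset N) k)
blockSequences N k = vectors (subsets N) k

op : Vec ℕ k → Permutation′ m → ℕ
op {k} b ρ = length (filter (avoider? b ρ) (blockSequences (sum b) k))

-- Every sequence of subsets is listed exactly once by blockSequences, so op is
-- the number of B satisfying Avoider.

vectors-complete : ∀ {A : Set} {xs : List A} → (∀ x → x List.∈ xs) →
                   ∀ {n} (v : Vec A n) → v List.∈ vectors xs n
vectors-complete all∈ []      = here refl
vectors-complete all∈ (x ∷ v) =
  ∈-cartesianProductWith⁺ _∷_ (all∈ x) (vectors-complete all∈ v)

vectors-unique : ∀ {A : Set} {xs : List A} → Unique xs → ∀ n → Unique (vectors xs n)
vectors-unique u zero    = ListAll.[] AllPairs.∷ AllPairs.[]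
vectors-unique u (suc n) =
  cartesianProductWith⁺ _∷_ ∷-injective u (vectors-unique u n)

subsets-complete : (p : Subset N) → p List.∈ subsets N
subsets-complete = vectors-complete λ { true → here refl ; false → there (here refl) }

subsets-unique : ∀ N → Unique (subsets N)
subsets-unique = vectors-unique
  (((λ ()) ListAll.∷ ListAll.[]) AllPairs.∷ ListAll.[] AllPairs.∷ AllPairs.[])

blockSequences-complete : (B : Vec (Subset N) k) → B List.∈ blockSequences N k
blockSequences-complete = vectors-complete subsets-complete

blockSequences-unique : ∀ N k → Unique (blockSequences N k)
blockSequences-unique N = vectors-unique (subsets-unique N)

-- One-line notation ρ₁ρ₂ρ₃, shifted to the letters 0, 1, 2.

perm123 : Permutation′ 3
perm123 = permutation ρ ρ ρ∘ρ ρ∘ρ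
  where
  ρ : Fin 3 → Fin 3
  ρ = lookup (0F ∷ 1F ∷ 2F ∷ [])
  ρ∘ρ : ∀ j → ρ (ρ j) ≡ j
  ρ∘ρ 0F = refl
  ρ∘ρ 1F = refl
  ρ∘ρ 2F = refl

perm132 : Permutation′ 3
perm132 = permutation ρ ρ ρ∘ρ ρ∘ρ
  where
  ρ : Fin 3 → Fin 3
  ρ = lookup (0F ∷ 2F ∷ 1F ∷ [])
  ρ∘ρ : ∀ j → ρ (ρ j) ≡ j
  ρ∘ρ 0F = refl
  ρ∘ρ 1F = refl
  ρ∘ρ 2F = refl

{-# OPTIONS --safe #-}

-- Record an ordered partition by the word w sending each x to the index of its
-- block.  Both patterns become "positions h < i < j with w h < w i, w h < w j
-- and w i ⊏ w j", where ⊏ is < for 123 and > for 132.  Scan a word from the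
-- left, m being one more than the least letter read so far.  A letter a < m may
-- always come next, and m becomes a + 1; a letter a ≥ m may come next only if
-- it is ⊏-maximal among the remaining letters ≥ m, so there is one choice for
-- it.  As m never grows, the letters ≥ m are interchangeable: the number of
-- completions depends only on their total number and on the multiplicities of
-- the letters < m, by a recursion in which ⊏ does not occur.

module Submission where

open import Defs
open import Data.Bool.Base using (true; false)
open import Data.Empty using (⊥-elim)
open import Data.Fin.Base as Fin using (Fin; zero; suc; toℕ)
open import Data.Fin.Induction using (spo-noetherian)
open import Data.Fin.Patterns using (0F; 1F; 2F)
open import Data.Fin.Permutation using (Permutation′)
open import Data.Fin.Properties as Fin using (_≟_; all?; any?)
open import Data.Fin.Subset using (Subset; ∣_∣; _∩_; Nonempty; Empty) renaming (_∈_ to _∈ˢ_)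
open import Data.Fin.Subset.Properties using (nonempty?; Empty-unique; ∣⊥∣≡0; x∈p∩q⁺; x∈p∩q⁻; x∈p⇒∣p-x∣<∣p∣; ⊆-antisym)
open import Data.List.Base as List using (List; _++_; allFin; cartesianProductWith; filter; length)
open import Data.List.Membership.Propositional using (_∈_)
open import Data.List.Membership.Propositional.Properties using (∈-allFin; ∈-filter⁺; ∈-filter⁻; ∈-map⁺; ∈-map⁻)
open import Data.List.Membership.Propositional.Properties.WithK using (unique∧set⇒bag)
open import Data.List.Properties using (filter-++; filter-accept; filter-≐; filter-none; length-++; length-map)
open import Data.List.Relation.Binary.BagAndSetEquality using (∼bag⇒↭)
open import Data.List.Relation.Binary.Permutation.Propositional.Properties using (↭-length)
import Data.List.Relation.Unary.All as ListAll
open import Data.List.Relation.Unary.Unique.Propositional using (Unique)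
open import Data.List.Relation.Unary.Unique.Propositional.Properties using (allFin⁺; filter⁺; map⁺)
open import Data.Nat.Base using (ℕ; zero; suc; pred; _+_; _≤_; _<_; z≤n; s≤s)
open import Data.Nat.Properties as ℕ using (_≤?_; _<?_)
open import Data.Nat.Tactic.RingSolver using (solve-∀)
open import Data.Product.Base using (∃; ∃-syntax; _×_; _,_; proj₁; proj₂)
open import Data.Vec.Base using (Vec; []; _∷_; lookup; sum; tabulate; map; _[_]≔_)
open import Data.Vec.Properties using (lookup∘tabulate; lookup∘update; lookup∘update′; lookup-map; tabulate-cong; tabulate∘lookup; []=⇒lookup; lookup⇒[]=)
open import Function.Base using (_∘_; flip; id)
open import Function.Bundles using (_⇔_; mk⇔; Equivalence)
open import Induction.WellFounded using (Acc; acc)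
open import Level using (0ℓ)
open import Relation.Binary.Construct.Flip.EqAndOrd using () renaming (isStrictTotalOrder to flip-isStrictTotalOrder)
open import Relation.Binary.Core using (Rel)
open import Relation.Binary.Definitions using (tri<; tri≈; tri>)
open import Relation.Binary.PropositionalEquality using (_≡_; _≢_; refl; sym; trans; cong; cong₂; subst; subst₂; module ≡-Reasoning)
open import Relation.Binary.Structures using (IsStrictTotalOrder)
open import Relation.Nullary using (¬_; Dec; does; yes; no; contradiction; ¬?; _×-dec_; _→-dec_)
open import Relation.Nullary.Decidable using (dec-true; dec-false; decidable-stable)
open import Relation.Unary using (Decidable; _≐_)

private
  variable
    k n N : ℕ

-- Vectors of naturals

lookup-ext : ∀ {A : Set} {u v : Vec A n} → (∀ i → lookup u i ≡ lookup v i) → u ≡ v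
lookup-ext {u = u} {v} eq =
  trans (sym (tabulate∘lookup u)) (trans (tabulate-cong eq) (tabulate∘lookup v))

-- Stated additively, with the overwritten entry on the left, so that no truncated subtraction
-- occurs.
sum-[]≔ : ∀ (v : Vec ℕ n) i y → sum (v [ i ]≔ y) + lookup v i ≡ sum v + y
sum-[]≔ (x ∷ v) zero    y = swap y (sum v) x
  where
  swap : ∀ y s x → (y + s) + x ≡ (x + s) + y
  swap = solve-∀
sum-[]≔ (x ∷ v) (suc i) y = begin
  (x + sum (v [ i ]≔ y)) + lookup v i  ≡⟨ ℕ.+-assoc x _ _ ⟩
  x + (sum (v [ i ]≔ y) + lookup v i)  ≡⟨ cong (x +_) (sum-[]≔ v i y) ⟩
  x + (sum v + y)                      ≡⟨ ℕ.+-assoc x _ _ ⟨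
  (x + sum v) + y                      ∎
  where open ≡-Reasoning

sum-mono-≤ : ∀ (u v : Vec ℕ n) → (∀ i → lookup u i ≤ lookup v i) → sum u ≤ sum v
sum-mono-≤ []      []      le = z≤n
sum-mono-≤ (x ∷ u) (y ∷ v) le = ℕ.+-mono-≤ (le zero) (sum-mono-≤ u v (le ∘ suc))

sum-mono-< : ∀ (u v : Vec ℕ n) → (∀ i → lookup u i ≤ lookup v i) →
             ∀ j → lookup u j < lookup v j → sum u < sum v
sum-mono-< (x ∷ u) (y ∷ v) le zero    lt = ℕ.+-mono-<-≤ lt (sum-mono-≤ u v (le ∘ suc))
sum-mono-< (x ∷ u) (y ∷ v) le (suc j) lt = ℕ.+-mono-≤-< (le zero) (sum-mono-< u v (le ∘ suc) j lt)

lookup≤sum : ∀ (v : Vec ℕ n) i → lookup v i ≤ sum v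
lookup≤sum (x ∷ v) zero    = ℕ.m≤m+n x (sum v)
lookup≤sum (x ∷ v) (suc i) = ℕ.≤-trans (lookup≤sum v i) (ℕ.m≤n+m (sum v) x)

≮0⇒≡0 : ∀ {m} → ¬ 0 < m → m ≡ 0
≮0⇒≡0 = ℕ.n≤0⇒n≡0 ∘ ℕ.≮⇒≥

suc-pred′ : ∀ {m} → 0 < m → suc (pred m) ≡ m
suc-pred′ {suc m} _ = refl

-- The multiplicities left once `a` has been read. Since `pred` fixes 0, the total drops only under
-- the assumption `0 < lookup c a`.
_−_ : Vec ℕ k → Fin k → Vec ℕ k
c − a = c [ a ]≔ pred (lookup c a)

sum-− : ∀ (c : Vec ℕ k) a → 0 < lookup c a → sum c ≡ suc n → sum (c − a) ≡ n
sum-− {n = n} c a 0<ca eq = ℕ.+-cancelʳ-≡ (lookup c a) _ _ (begin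
  sum (c − a) + lookup c a    ≡⟨ sum-[]≔ c a _ ⟩
  sum c + pred (lookup c a)   ≡⟨ cong (_+ pred (lookup c a)) eq ⟩
  suc n + pred (lookup c a)   ≡⟨ ℕ.+-suc n _ ⟨
  n + suc (pred (lookup c a)) ≡⟨ cong (n +_) (suc-pred′ 0<ca) ⟩
  n + lookup c a              ∎)
  where open ≡-Reasoning

−-cong : ∀ (c c′ : Vec ℕ k) a x → lookup c a ≡ lookup c′ a → lookup c x ≡ lookup c′ x →
         lookup (c − a) x ≡ lookup (c′ − a) x
−-cong c c′ a x eqa eqx with x ≟ a
... | yes refl = trans (lookup∘update a c _) (trans (cong pred eqa) (sym (lookup∘update a c′ _)))
... | no  x≢a  = trans (lookup∘update′ x≢a c _) (trans eqx (sym (lookup∘update′ x≢a c′ _)))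

-- Once the entries at `p` and `q` are overwritten by 0 the two tables coincide, and the overwritten
-- entries are equal. This compares sums over the first letter of a word when each order singles out
-- its own letter at or above `m`.
sum-tabulate-exchange :
  ∀ (t t′ : Fin k → ℕ) m p q → m ≤ toℕ p → m ≤ toℕ q →
  (∀ a → toℕ a < m → t a ≡ t′ a) →
  (∀ a → m ≤ toℕ a → a ≢ p → t a ≡ 0) →
  (∀ a → m ≤ toℕ a → a ≢ q → t′ a ≡ 0) →
  t p ≡ t′ q → sum (tabulate t) ≡ sum (tabulate t′)
sum-tabulate-exchange {k} t t′ m p q m≤p m≤q low high high′ tp≡t′q = begin
  sum (tabulate t)                   ≡⟨ split t p ⟩
  sum (tabulate t [ p ]≔ 0) + t p    ≡⟨ cong₂ _+_ (cong sum zeroed) tp≡t′q ⟩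
  sum (tabulate t′ [ q ]≔ 0) + t′ q  ≡⟨ split t′ q ⟨
  sum (tabulate t′)                  ∎
  where
  open ≡-Reasoning

  split : ∀ (s : Fin k → ℕ) r → sum (tabulate s) ≡ sum (tabulate s [ r ]≔ 0) + s r
  split s r = sym (trans (cong (sum (tabulate s [ r ]≔ 0) +_) (sym (lookup∘tabulate s r)))
                         (trans (sum-[]≔ (tabulate s) r 0) (ℕ.+-identityʳ _)))

  at-low : ∀ (s : Fin k → ℕ) {r} → m ≤ toℕ r → ∀ a → toℕ a < m →
           lookup (tabulate s [ r ]≔ 0) a ≡ s a
  at-low s m≤r a a<m =
    trans (lookup∘update′ (λ { refl → ℕ.<⇒≱ a<m m≤r }) (tabulate s) 0) (lookup∘tabulate s a)

  at-high : ∀ (s : Fin k → ℕ) r → (∀ a → m ≤ toℕ a → a ≢ r → s a ≡ 0) →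
            ∀ a → m ≤ toℕ a → lookup (tabulate s [ r ]≔ 0) a ≡ 0
  at-high s r zeros a m≤a with a ≟ r
  ... | yes refl = lookup∘update a (tabulate s) 0
  ... | no  a≢r  =
    trans (lookup∘update′ a≢r (tabulate s) 0) (trans (lookup∘tabulate s a) (zeros a m≤a a≢r))

  eq : ∀ a → lookup (tabulate t [ p ]≔ 0) a ≡ lookup (tabulate t′ [ q ]≔ 0) a
  eq a with toℕ a <? m
  ... | yes a<m = trans (at-low t m≤p a a<m) (trans (low a a<m) (sym (at-low t′ m≤q a a<m)))
  ... | no  a≮m = trans (at-high t p high a (ℕ.≮⇒≥ a≮m)) (sym (at-high t′ q high′ a (ℕ.≮⇒≥ a≮m)))

  zeroed : tabulate t [ p ]≔ 0 ≡ tabulate t′ [ q ]≔ 0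
  zeroed = lookup-ext eq

-- Counting by enumeration

filter-map-length : ∀ {A B : Set} {P : B → Set} (P? : Decidable P) (f : A → B) xs →
                    length (filter P? (List.map f xs)) ≡ length (filter (P? ∘ f) xs)
filter-map-length P? f List.[]       = refl
filter-map-length P? f (x List.∷ xs) with does (P? (f x))
... | true  = cong suc (filter-map-length P? f xs)
... | false = filter-map-length P? f xs

-- The function `g` makes the induction possible: the tail of `List.tabulate g` is tabulated by
-- `g ∘ suc`.
filter-product-length :
  ∀ {A B C : Set} {P : C → Set} (P? : Decidable P) (f : A → B → C) (g : Fin n → A) ys →
  length (filter P? (cartesianProductWith f (List.tabulate g) ys)) ≡
  sum (tabulate λ i → length (filter (P? ∘ f (g i)) ys))
filter-product-length {n = zero}  P? f g ys = refl
filter-product-length {n = suc n} P? f g ys = begin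
  length (filter P? (first ++ rest))                   ≡⟨ cong length (filter-++ P? first rest) ⟩
  length (filter P? first ++ filter P? rest)           ≡⟨ length-++ (filter P? first) ⟩
  length (filter P? first) + length (filter P? rest)   ≡⟨ cong₂ _+_ (filter-map-length P? (f (g zero)) ys)
                                                                    (filter-product-length P? f (g ∘ suc) ys) ⟩
  sum (tabulate λ i → length (filter (P? ∘ f (g i)) ys)) ∎
  where
  open ≡-Reasoning
  first = List.map (f (g zero)) ys
  rest  = cartesianProductWith f (List.tabulate (g ∘ suc)) ys

-- The filtered `xs` and the image under `f` of the filtered `ys` are duplicate-free lists with the
-- same members, hence permutations of each other.
filter-bijection-length :
  ∀ {A B : Set} {P : A → Set} {Q : B → Set} (P? : Decidable P) (Q? : Decidable Q)
  {xs : List A} {ys : List B} → Unique xs → (∀ x → x ∈ xs) → Unique ys → (∀ y → y ∈ ys) →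
  (f : B → A) → (∀ {y y′} → f y ≡ f y′ → y ≡ y′) →
  (∀ x → P x → ∃[ y ] Q y × x ≡ f y) → (∀ y → Q y → P (f y)) →
  length (filter P? xs) ≡ length (filter Q? ys)
filter-bijection-length P? Q? {xs} {ys} uxs ∈xs uys ∈ys f f-inj P⇒Q Q⇒P = trans
  (↭-length (∼bag⇒↭ (unique∧set⇒bag (filter⁺ P? uxs) (map⁺ f-inj (filter⁺ Q? uys)) (mk⇔ to from))))
  (length-map f (filter Q? ys))
  where
  to : ∀ {x} → x ∈ filter P? xs → x ∈ List.map f (filter Q? ys)
  to {x} x∈ with P⇒Q x (proj₂ (∈-filter⁻ P? {xs = xs} x∈))
  ... | y , Qy , refl = ∈-map⁺ f (∈-filter⁺ Q? (∈ys y) Qy)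

  from : ∀ {x} → x ∈ List.map f (filter Q? ys) → x ∈ filter P? xs
  from x∈ with ∈-map⁻ f x∈
  ... | y , y∈ , refl = ∈-filter⁺ P? (∈xs (f y)) (Q⇒P y (proj₂ (∈-filter⁻ Q? {xs = ys} y∈)))

words : ∀ k n → List (Vec (Fin k) n)
words k = vectors (allFin k)

#_ : {P : Vec (Fin k) n → Set} → Decidable P → ℕ
#_ {k} {n} P? = length (filter P? (words k n))

#-cons : {P : Vec (Fin k) (suc n) → Set} (P? : Decidable P) →
         # P? ≡ sum (tabulate λ a → # (P? ∘ (a ∷_)))
#-cons P? = filter-product-length P? _∷_ id _

#-cong : {P Q : Vec (Fin k) n → Set} (P? : Decidable P) (Q? : Decidable Q) →
         P ≐ Q → # P? ≡ # Q?
#-cong {k} {n} P? Q? P≐Q = cong length (filter-≐ P? Q? P≐Q (words k n))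

#-none : {P : Vec (Fin k) n → Set} (P? : Decidable P) → (∀ w → ¬ P w) → # P? ≡ 0
#-none {k} {n} P? ¬P = cong length (filter-none P? (ListAll.universal ¬P (words k n)))

-- Words and sequences of blocks

block : Vec (Fin k) N → Fin k → Subset N
block w a = map (λ y → does (y ≟ a)) w

blocks : Vec (Fin k) N → Vec (Subset N) k
blocks w = tabulate (block w)

∈-block⁺ : ∀ (w : Vec (Fin k) N) {x a} → lookup w x ≡ a → x ∈ˢ block w a
∈-block⁺ w {x} {a} eq =
  lookup⇒[]= x _ (trans (lookup-map x _ w) (dec-true (lookup w x ≟ a) eq))

∈-block⁻ : ∀ (w : Vec (Fin k) N) {x a} → x ∈ˢ block w a → lookup w x ≡ a
∈-block⁻ w {x} {a} x∈ = decidable-stable (lookup w x ≟ a) λ neq →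
  contradiction (trans (sym (trans (sym (lookup-map x _ w)) ([]=⇒lookup x∈)))
                       (dec-false (lookup w x ≟ a) neq)) λ ()

lookup-blocks : ∀ (w : Vec (Fin k) N) a → lookup (blocks w) a ≡ block w a
lookup-blocks w = lookup∘tabulate (block w)

∈-blocks⁺ : ∀ (w : Vec (Fin k) N) {x a} → lookup w x ≡ a → x ∈ˢ lookup (blocks w) a
∈-blocks⁺ w {x} {a} eq = subst (x ∈ˢ_) (sym (lookup-blocks w a)) (∈-block⁺ w eq)

∈-blocks⁻ : ∀ (w : Vec (Fin k) N) {x a} → x ∈ˢ lookup (blocks w) a → lookup w x ≡ a
∈-blocks⁻ w {x} {a} x∈ = ∈-block⁻ w (subst (x ∈ˢ_) (lookup-blocks w a) x∈)

-- Position `x` lies in block `lookup v x` of `blocks v`, hence of `blocks w`, which determines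
-- `lookup w x`.
blocks-injective : ∀ {v w : Vec (Fin k) N} → blocks v ≡ blocks w → v ≡ w
blocks-injective {v = v} {w} eq = lookup-ext λ x →
  sym (∈-blocks⁻ w (subst (λ B → x ∈ˢ lookup B (lookup v x)) eq (∈-blocks⁺ v refl)))

∣p∣>0⇒Nonempty : ∀ (p : Subset N) → 0 < ∣ p ∣ → Nonempty p
∣p∣>0⇒Nonempty {N} p 0<∣p∣ = decidable-stable (nonempty? p) λ empty →
  ℕ.<⇒≢ 0<∣p∣ (sym (trans (cong ∣_∣ (Empty-unique empty)) (∣⊥∣≡0 N)))

-- Words with prescribed letter multiplicities

HasContent : Vec ℕ k → Vec (Fin k) n → Set
HasContent c w = ∀ a → ∣ block w a ∣ ≡ lookup c a

hasContent? : ∀ (c : Vec ℕ k) → Decidable (HasContent {n = n} c)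
hasContent? c w = all? λ a → ∣ block w a ∣ ℕ.≟ lookup c a

∣block∣-here : ∀ a (w : Vec (Fin k) n) → ∣ block (a ∷ w) a ∣ ≡ suc ∣ block w a ∣
∣block∣-here a w rewrite dec-true (a ≟ a) refl = refl

∣block∣-there : ∀ {a b} (w : Vec (Fin k) n) → b ≢ a → ∣ block (a ∷ w) b ∣ ≡ ∣ block w b ∣
∣block∣-there {a = a} {b} w b≢a rewrite dec-false (a ≟ b) (b≢a ∘ sym) = refl

HasContent-[] : ∀ (c : Vec ℕ k) → sum c ≡ 0 → HasContent c []
HasContent-[] c eq a = sym (ℕ.n≤0⇒n≡0 (subst (lookup c a ≤_) eq (lookup≤sum c a)))

module _ (c : Vec ℕ k) (a : Fin k) (w : Vec (Fin k) n) where

  HasContent-head : HasContent c (a ∷ w) → 0 < lookup c a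
  HasContent-head h = subst (0 <_) (trans (sym (∣block∣-here a w)) (h a)) (s≤s z≤n)

  HasContent-tail : HasContent c (a ∷ w) → HasContent (c − a) w
  HasContent-tail h x with x ≟ a
  ... | yes refl = trans (cong pred (trans (sym (∣block∣-here a w)) (h a))) (sym (lookup∘update a c _))
  ... | no  x≢a  = trans (trans (sym (∣block∣-there w x≢a)) (h x)) (sym (lookup∘update′ x≢a c _))

  HasContent-∷ : 0 < lookup c a → HasContent (c − a) w → HasContent c (a ∷ w)
  HasContent-∷ 0<ca h x with x ≟ a
  ... | yes refl = trans (∣block∣-here a w)
                         (trans (cong suc (trans (h a) (lookup∘update a c _))) (suc-pred′ 0<ca))
  ... | no  x≢a  = trans (∣block∣-there w x≢a) (trans (h x) (lookup∘update′ x≢a c _))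

occurs : ∀ (c : Vec ℕ k) (w : Vec (Fin k) n) → HasContent c w →
         ∀ a → 0 < lookup c a → ∃[ j ] lookup w j ≡ a
occurs c w h a 0<ca with ∣p∣>0⇒Nonempty (block w a) (subst (0 <_) (sym (h a)) 0<ca)
... | j , j∈ = j , ∈-block⁻ w j∈

occurs⇒>0 : ∀ (c : Vec ℕ k) (w : Vec (Fin k) n) → HasContent c w →
            ∀ j → 0 < lookup c (lookup w j)
occurs⇒>0 c w h j =
  -- Removing position `j` makes its block strictly smaller, so the block has positive size.
  subst (0 <_) (h (lookup w j)) (ℕ.≤-<-trans z≤n (x∈p⇒∣p-x∣<∣p∣ (∈-block⁺ w {j} refl)))

-- Avoiding words

module Avoidance (_⊏_ : Rel (Fin k) 0ℓ) where

  -- The constraint left by the letters already read: letters at or above `m` exceed the earlier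
  -- letter `m − 1`, so two of them in relation `⊏` would complete a forbidden triple.
  AvoidsPairs : ℕ → Vec (Fin k) n → Set
  AvoidsPairs m w = ∀ i j → i Fin.< j → m ≤ toℕ (lookup w i) → m ≤ toℕ (lookup w j) →
                    ¬ lookup w i ⊏ lookup w j

  AvoidsTriples : Vec (Fin k) n → Set
  AvoidsTriples w = ∀ h i j → h Fin.< i → i Fin.< j →
                    lookup w h Fin.< lookup w i → lookup w h Fin.< lookup w j →
                    ¬ lookup w i ⊏ lookup w j

  -- w continues a word whose least letter is m − 1; m = k stands for the empty word.
  AvoidsAfter : ℕ → Vec (Fin k) n → Set
  AvoidsAfter m w = AvoidsPairs m w × AvoidsTriples w

  module _ (m : ℕ) (a : Fin k) (w : Vec (Fin k) n) where

    AvoidsAfter-tail : AvoidsAfter m (a ∷ w) → AvoidsAfter m w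
    AvoidsAfter-tail (pairs , triples) =
      (λ i j i<j → pairs (suc i) (suc j) (s≤s i<j)) ,
      (λ h i j h<i i<j → triples (suc h) (suc i) (suc j) (s≤s h<i) (s≤s i<j))

    -- Triples starting at the new first position turn into the pair condition for letters above
    -- `a`.
    AvoidsAfter-low⁻ : AvoidsAfter m (a ∷ w) → AvoidsAfter (suc (toℕ a)) w
    AvoidsAfter-low⁻ av@(_ , triples) =
      (λ i j i<j → triples zero (suc i) (suc j) (s≤s z≤n) (s≤s i<j)) ,
      proj₂ (AvoidsAfter-tail av)

    -- As `a` is below `m`, it belongs to no pair at threshold `m`, and pairs at or above `m` are
    -- among those above `a`.
    AvoidsAfter-low⁺ : toℕ a < m → AvoidsAfter (suc (toℕ a)) w → AvoidsAfter m (a ∷ w)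
    AvoidsAfter-low⁺ a<m (pairs , triples) = pairs′ , triples′
      where
      pairs′ : AvoidsPairs m (a ∷ w)
      pairs′ zero    j       _         m≤a _   = contradiction m≤a (ℕ.<⇒≱ a<m)
      pairs′ (suc i) (suc j) (s≤s i<j) m≤i m≤j =
        pairs i j i<j (ℕ.≤-trans a<m m≤i) (ℕ.≤-trans a<m m≤j)
      triples′ : AvoidsTriples (a ∷ w)
      triples′ zero    (suc i) (suc j) _         (s≤s i<j) = pairs i j i<j
      triples′ (suc h) (suc i) (suc j) (s≤s h<i) (s≤s i<j) = triples h i j h<i i<j

    -- A triple starting with `a` contains a pair above `a`, hence above `m`, which is already
    -- excluded. Only the pairs starting with `a` are new, and maximality excludes these.
    AvoidsAfter-high⁺ : m ≤ toℕ a → (∀ j → m ≤ toℕ (lookup w j) → ¬ a ⊏ lookup w j) →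
                        AvoidsAfter m w → AvoidsAfter m (a ∷ w)
    AvoidsAfter-high⁺ m≤a max (pairs , triples) = pairs′ , triples′
      where
      pairs′ : AvoidsPairs m (a ∷ w)
      pairs′ zero    (suc j) _         _   m≤j = max j m≤j
      pairs′ (suc i) (suc j) (s≤s i<j) m≤i m≤j = pairs i j i<j m≤i m≤j
      triples′ : AvoidsTriples (a ∷ w)
      triples′ zero    (suc i) (suc j) _         (s≤s i<j) a<i a<j =
        pairs i j i<j (ℕ.≤-trans m≤a (ℕ.<⇒≤ a<i)) (ℕ.≤-trans m≤a (ℕ.<⇒≤ a<j))
      triples′ (suc h) (suc i) (suc j) (s≤s h<i) (s≤s i<j) = triples h i j h<i i<j

-- Letters still available at or above the threshold

High : ℕ → Vec ℕ k → Fin k → Set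
High m c a = m ≤ toℕ a × 0 < lookup c a

high? : ∀ m (c : Vec ℕ k) → Decidable (High m c)
high? m c a = (m ≤? toℕ a) ×-dec (0 <? lookup c a)

AgreeBelow : ℕ → Vec ℕ k → Vec ℕ k → Set
AgreeBelow m c c′ = ∀ a → toℕ a < m → lookup c a ≡ lookup c′ a

-- If `c` vanished at and above `m`, it would be entrywise at most `c′` and strictly smaller at `b`,
-- contradicting the equal totals.
high-transfer : ∀ m (c c′ : Vec ℕ k) → sum c ≡ sum c′ → AgreeBelow m c c′ →
                ∃ (High m c′) → ∃ (High m c)
high-transfer m c c′ Σ≡ agree (b , m≤b , 0<c′b) = decidable-stable (any? (high? m c)) impossible
  where
  impossible : ¬ ¬ ∃ (High m c)
  impossible none = ℕ.<⇒≢ (sum-mono-< c c′ c≤c′ b cb<c′b) Σ≡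
    where
    zeroAbove : ∀ a → m ≤ toℕ a → lookup c a ≡ 0
    zeroAbove a m≤a = ≮0⇒≡0 λ 0<ca → none (a , m≤a , 0<ca)

    cb<c′b : lookup c b < lookup c′ b
    cb<c′b = subst (_< lookup c′ b) (sym (zeroAbove b m≤b)) 0<c′b

    c≤c′ : ∀ a → lookup c a ≤ lookup c′ a
    c≤c′ a with toℕ a <? m
    ... | yes a<m = ℕ.≤-reflexive (agree a a<m)
    ... | no  a≮m = subst (_≤ lookup c′ a) (sym (zeroAbove a (ℕ.≮⇒≥ a≮m))) z≤n

-- Counting completions by their first letter

module AvoiderCount {_⊏_ : Rel (Fin k) 0ℓ} (isSTO : IsStrictTotalOrder _≡_ _⊏_) where

  open Avoidance _⊏_ public
  private module ⊏ = IsStrictTotalOrder isSTO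

  avoidsAfter? : ∀ m → Decidable (AvoidsAfter {n} m)
  avoidsAfter? m w =
    (all? λ i → all? λ j → (i Fin.<? j) →-dec (m ≤? toℕ (lookup w i)) →-dec
       (m ≤? toℕ (lookup w j)) →-dec ¬? (lookup w i ⊏.<? lookup w j))
    ×-dec
    (all? λ h → all? λ i → all? λ j → (h Fin.<? i) →-dec (i Fin.<? j) →-dec
       (lookup w h Fin.<? lookup w i) →-dec (lookup w h Fin.<? lookup w j) →-dec
       ¬? (lookup w i ⊏.<? lookup w j))

  Good : ℕ → Vec ℕ k → Vec (Fin k) n → Set
  Good m c w = HasContent c w × AvoidsAfter m w

  good? : ∀ m c → Decidable (Good {n} m c)
  good? m c w = hasContent? c w ×-dec avoidsAfter? m w

  completions : ∀ n → ℕ → Vec ℕ k → ℕ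
  completions n m c = # (good? {n} m c)

  completionsVia : ∀ n → ℕ → Vec ℕ k → Fin k → ℕ
  completionsVia n m c a = # (good? {suc n} m c ∘ (a ∷_))

  via-absent : ∀ n m c {a} → ¬ 0 < lookup c a → completionsVia n m c a ≡ 0
  via-absent n m c {a} ca≯0 = #-none (good? {suc n} m c ∘ (a ∷_))
    λ { w (content , _) → ca≯0 (HasContent-head c a w content) }

  via-low : ∀ n m c {a} → 0 < lookup c a → toℕ a < m →
            completionsVia n m c a ≡ completions n (suc (toℕ a)) (c − a)
  via-low n m c {a} 0<ca a<m = #-cong (good? {suc n} m c ∘ (a ∷_)) (good? {n} (suc (toℕ a)) (c − a))
    ( (λ { {w} (content , av) → HasContent-tail c a w content , AvoidsAfter-low⁻ m a w av })
    , (λ { {w} (content , av) → HasContent-∷ c a w 0<ca content , AvoidsAfter-low⁺ m a w a<m av }) )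

  -- The letter `b` must still occur. It differs from `a`, so it comes later and forms a forbidden
  -- pair with `a`.
  via-dominated : ∀ n m c {a b} → m ≤ toℕ a → High m c b → a ⊏ b → completionsVia n m c a ≡ 0
  via-dominated n m c {a} {b} m≤a (m≤b , 0<cb) a⊏b = #-none (good? {suc n} m c ∘ (a ∷_)) none
    where
    none : ∀ (w : Vec (Fin k) n) → ¬ Good m c (a ∷ w)
    none w (content , pairs , _) with occurs c (a ∷ w) content b 0<cb
    ... | zero  , refl = ⊏.irrefl refl a⊏b
    ... | suc j , refl = pairs zero (suc j) (s≤s z≤n) m≤a m≤b a⊏b

  -- A maximal first letter starts no forbidden pair, and being at least `m` it leaves the threshold
  -- unchanged.
  via-maximal : ∀ n m c {a} → High m c a → (∀ {b} → High m c b → ¬ a ⊏ b) →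
                completionsVia n m c a ≡ completions n m (c − a)
  via-maximal n m c {a} (m≤a , 0<ca) max = #-cong (good? {suc n} m c ∘ (a ∷_)) (good? {n} m (c − a))
    ( (λ { {w} (content , av) → HasContent-tail c a w content , AvoidsAfter-tail m a w av })
    , (λ { {w} (content , av) →
         let content′ = HasContent-∷ c a w 0<ca content in
         content′ ,
         AvoidsAfter-high⁺ m a w m≤a
           -- The letter is located in the whole word `a ∷ w`, so its multiplicity is positive in
           -- `c` itself, as `max` requires.
           (λ j m≤j → max (m≤j , occurs⇒>0 c (a ∷ w) content′ (suc j))) av }) )

  -- Climbing along `⊏` inside `P` terminates because a strict order on a finite set is noetherian.
  maximal : ∀ {P : Fin k → Set} → Decidable P → ∃ P → ∃[ p ] P p × (∀ {b} → P b → ¬ p ⊏ b)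
  maximal {P} P? (a , Pa) = go (spo-noetherian ⊏.isStrictPartialOrder a) Pa
    where
    go : ∀ {a} → Acc (flip _⊏_) a → P a → ∃[ p ] P p × (∀ {b} → P b → ¬ p ⊏ b)
    go {a} (acc rs) Pa with any? (λ b → P? b ×-dec (a ⊏.<? b))
    ... | yes (b , Pb , a⊏b) = go (rs a⊏b) Pb
    ... | no  none           = a , Pa , λ Pb a⊏b → none (_ , Pb , a⊏b)

  -- What the comparison of two orders uses when a letter at or above `m` is available. The letter
  -- itself depends on the order, but the shape of the recursion does not.
  record UniqueHighStep (n m : ℕ) (c : Vec ℕ k) : Set where
    field
      letter : Fin k
      isHigh : High m c letter
      via    : completionsVia n m c letter ≡ completions n m (c − letter)
      others : ∀ a → m ≤ toℕ a → a ≢ letter → completionsVia n m c a ≡ 0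

  -- By trichotomy, any other available letter at or above `m` lies `⊏`-below the maximal one and is
  -- therefore dominated.
  uniqueHighStep : ∀ n m c → ∃ (High m c) → UniqueHighStep n m c
  uniqueHighStep n m c ∃high with maximal (high? m c) ∃high
  ... | p , highp , max = record
    { letter = p ; isHigh = highp ; via = via-maximal n m c highp max ; others = others }
    where
    others : ∀ a → m ≤ toℕ a → a ≢ p → completionsVia n m c a ≡ 0
    others a m≤a a≢p with 0 <? lookup c a
    ... | no  ca≯0 = via-absent n m c ca≯0
    ... | yes 0<ca with ⊏.compare a p
    ...   | tri< a⊏p _ _ = via-dominated n m c m≤a highp a⊏p
    ...   | tri≈ _ a≡p _ = contradiction a≡p a≢p
    ...   | tri> _ _ p⊏a = contradiction p⊏a (max (m≤a , 0<ca))

-- Independence of the order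

module _ {_⊏₁_ _⊏₂_ : Rel (Fin k) 0ℓ}
         (isSTO₁ : IsStrictTotalOrder _≡_ _⊏₁_) (isSTO₂ : IsStrictTotalOrder _≡_ _⊏₂_) where

  private
    module C₁ = AvoiderCount isSTO₁
    module C₂ = AvoiderCount isSTO₂

  -- Induction on the length, splitting by first letter. Two vectors `c` and `c′` occur because the
  -- orders may consume different letters at or above `m`; equal totals and agreement below the
  -- threshold survive every step.
  completions-independent : ∀ n m (c c′ : Vec ℕ k) → sum c ≡ n → sum c′ ≡ n → AgreeBelow m c c′ →
                            C₁.completions n m c ≡ C₂.completions n m c′
  completions-independent zero m c c′ Σc Σc′ agree =
    trans (empty (C₁.good? m c) (HasContent-[] c Σc , (λ ()) , (λ ())))
          (sym (empty (C₂.good? m c′) (HasContent-[] c′ Σc′ , (λ ()) , (λ ()))))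
    where
    empty : {P : Vec (Fin k) 0 → Set} (P? : Decidable P) → P [] → # P? ≡ 1
    empty P? P[] = cong length (filter-accept P? {xs = List.[]} P[])
  completions-independent (suc n) m c c′ Σc Σc′ agree = begin
    C₁.completions (suc n) m c                    ≡⟨ #-cons (C₁.good? m c) ⟩
    sum (tabulate (C₁.completionsVia n m c))      ≡⟨ sums (any? (high? m c)) ⟩
    sum (tabulate (C₂.completionsVia n m c′))     ≡⟨ #-cons (C₂.good? m c′) ⟨
    C₂.completions (suc n) m c′                   ∎
    where
    open ≡-Reasoning

    Via≡ : Fin k → Set
    Via≡ a = C₁.completionsVia n m c a ≡ C₂.completionsVia n m c′ a

    low′ : ∀ a → toℕ a < m → Dec (0 < lookup c a) → Via≡ a
    low′ a a<m (no  ca≯0) =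
      trans (C₁.via-absent n m c ca≯0)
            (sym (C₂.via-absent n m c′ (ca≯0 ∘ subst (0 <_) (sym (agree a a<m)))))
    low′ a a<m (yes 0<ca) =
      trans (C₁.via-low n m c 0<ca a<m) (trans remaining (sym (C₂.via-low n m c′ 0<c′a a<m)))
      where
      0<c′a = subst (0 <_) (agree a a<m) 0<ca

      remaining : C₁.completions n (suc (toℕ a)) (c − a) ≡ C₂.completions n (suc (toℕ a)) (c′ − a)
      remaining = completions-independent n (suc (toℕ a)) (c − a) (c′ − a)
        (sum-− c a 0<ca Σc) (sum-− c′ a 0<c′a Σc′)
        -- The threshold falls to `suc (toℕ a)`, at most `m`, so the old agreement covers the new
        -- range.
        λ x x≤a → −-cong c c′ a x (agree a a<m) (agree x (ℕ.≤-trans x≤a a<m))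

    low : ∀ a → toℕ a < m → Via≡ a
    low a a<m = low′ a a<m (0 <? lookup c a)

    sums : Dec (∃ (High m c)) →
           sum (tabulate (C₁.completionsVia n m c)) ≡ sum (tabulate (C₂.completionsVia n m c′))
    sums (no none) = cong sum (tabulate-cong λ a → pointwise a (toℕ a <? m))
      where
      none′ : ¬ ∃ (High m c′)
      none′ = none ∘ high-transfer m c c′ (trans Σc (sym Σc′)) agree

      pointwise : ∀ a → Dec (toℕ a < m) → Via≡ a
      pointwise a (yes a<m) = low a a<m
      pointwise a (no  a≮m) =
        trans (C₁.via-absent n m c λ 0<ca → none (a , ℕ.≮⇒≥ a≮m , 0<ca))
              (sym (C₂.via-absent n m c′ λ 0<c′a → none′ (a , ℕ.≮⇒≥ a≮m , 0<c′a)))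
    sums (yes ∃high) =
      sum-tabulate-exchange (C₁.completionsVia n m c) (C₂.completionsVia n m c′) m
        S₁.letter S₂.letter (proj₁ S₁.isHigh) (proj₁ S₂.isHigh) low S₁.others S₂.others
        (trans S₁.via (trans remaining (sym S₂.via)))
      where
      module S₁ = C₁.UniqueHighStep (C₁.uniqueHighStep n m c ∃high)
      module S₂ = C₂.UniqueHighStep (C₂.uniqueHighStep n m c′
        (high-transfer m c′ c (trans Σc′ (sym Σc)) (λ a a<m → sym (agree a a<m)) ∃high))

      unchanged : ∀ (d : Vec ℕ k) {p} → m ≤ toℕ p → ∀ a → toℕ a < m → lookup (d − p) a ≡ lookup d a
      unchanged d m≤p a a<m = lookup∘update′ (λ { refl → ℕ.<⇒≱ a<m m≤p }) d _

      remaining : C₁.completions n m (c − S₁.letter) ≡ C₂.completions n m (c′ − S₂.letter)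
      remaining = completions-independent n m (c − S₁.letter) (c′ − S₂.letter)
        (sum-− c S₁.letter (proj₂ S₁.isHigh) Σc) (sum-− c′ S₂.letter (proj₂ S₂.isHigh) Σc′)
        -- The removed letters are both at or above `m`, so the entries below `m` are untouched.
        λ a a<m → trans (unchanged c (proj₁ S₁.isHigh) a a<m)
                        (trans (agree a a<m) (sym (unchanged c′ (proj₁ S₂.isHigh) a a<m)))

-- Ordered partitions as words

blocks-isOrderedPartition : ∀ (c : Vec ℕ k) (w : Vec (Fin k) N) → (∀ i → 0 < lookup c i) →
                            HasContent c w → IsOrderedPartition (blocks w)
blocks-isOrderedPartition c w 0<c content = nonempty , disjoint , cover
  where
  nonempty : ∀ i → Nonempty (lookup (blocks w) i)
  nonempty i with occurs c w content i (0<c i)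
  ... | x , eq = x , ∈-blocks⁺ w eq

  disjoint : ∀ i j → i ≢ j → Empty (lookup (blocks w) i ∩ lookup (blocks w) j)
  disjoint i j i≢j (x , x∈) with x∈p∩q⁻ (lookup (blocks w) i) _ x∈
  ... | x∈i , x∈j = i≢j (trans (sym (∈-blocks⁻ w x∈i)) (∈-blocks⁻ w x∈j))

  cover : ∀ x → ∃[ i ] x ∈ˢ lookup (blocks w) i
  cover x = lookup w x , ∈-blocks⁺ w refl

-- The word takes at `x` the block index supplied by the covering property; disjointness makes this
-- index unique.
isOrderedPartition⇒blocks : ∀ (B : Vec (Subset N) k) → IsOrderedPartition B → ∃[ w ] B ≡ blocks w
isOrderedPartition⇒blocks B (_ , disjoint , cover) = w , lookup-ext λ a →
  ⊆-antisym (λ x∈ → ∈-blocks⁺ w (B⇒w x∈)) (λ x∈ → w⇒B (∈-blocks⁻ w x∈))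
  where
  w = tabulate (proj₁ ∘ cover)

  w⇒B : ∀ {x a} → lookup w x ≡ a → x ∈ˢ lookup B a
  w⇒B {x} eq = subst (λ a → x ∈ˢ lookup B a)
    (trans (sym (lookup∘tabulate (proj₁ ∘ cover) x)) eq) (proj₂ (cover x))

  B⇒w : ∀ {x a} → x ∈ˢ lookup B a → lookup w x ≡ a
  B⇒w {x} {a} x∈ = decidable-stable (lookup w x ≟ a) λ wx≢a →
    disjoint (lookup w x) a wx≢a (x , x∈p∩q⁺ (w⇒B refl , x∈))

HasContent⇔HasBlockSizes : ∀ (c : Vec ℕ k) (w : Vec (Fin k) N) →
                           HasContent c w ⇔ HasBlockSizes c (blocks w)
HasContent⇔HasBlockSizes c w = mk⇔
  (λ h i → trans (cong ∣_∣ (lookup-blocks w i)) (h i))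
  (λ h i → trans (cong ∣_∣ (sym (lookup-blocks w i))) (h i))

module _ {_⊏_ : Rel (Fin k) 0ℓ} (isSTO : IsStrictTotalOrder _≡_ _⊏_) (ρ : Permutation′ 3)
         (avoids⇔ : ∀ {N} (w : Vec (Fin k) N) →
                    Avoids ρ (blocks w) ⇔ Avoidance.AvoidsTriples _⊏_ w) where

  open AvoiderCount isSTO

  op≡completions : ∀ (b : Vec ℕ k) → (∀ i → 0 < lookup b i) → op b ρ ≡ completions (sum b) k b
  op≡completions b 0<b = filter-bijection-length (avoider? b ρ) (good? k b)
    (blockSequences-unique (sum b) k) blockSequences-complete
    (vectors-unique (allFin⁺ k) (sum b)) (vectors-complete ∈-allFin)
    blocks blocks-injective to from
    where
    to : ∀ B → Avoider b ρ B → ∃[ w ] Good k b w × B ≡ blocks w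
    to B (partition , sizes , avoids) with isOrderedPartition⇒blocks B partition
    ... | w , refl = w ,
      ( Equivalence.from (HasContent⇔HasBlockSizes b w) sizes
      -- At the initial threshold `k` the pair condition is vacuous, since every letter is below
      -- `k`.
      , (λ i j i<j k≤wi → contradiction k≤wi (ℕ.<⇒≱ (Fin.toℕ<n (lookup w i))))
      , Equivalence.to (avoids⇔ w) avoids ) , refl

    from : ∀ w → Good k b w → Avoider b ρ (blocks w)
    from w (content , _ , triples) =
      blocks-isOrderedPartition b w 0<b content ,
      Equivalence.to (HasContent⇔HasBlockSizes b w) content ,
      Equivalence.from (avoids⇔ w) triples

-- The patterns 123 and 132 as conditions on words

strictlyIncreasing₃ : ∀ {a b c : Fin n} → a Fin.< b → b Fin.< c → StrictlyIncreasing (a ∷ b ∷ c ∷ [])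
strictlyIncreasing₃ a<b b<c 0F 1F _ = a<b
strictlyIncreasing₃ a<b b<c 0F 2F _ = ℕ.<-trans a<b b<c
strictlyIncreasing₃ a<b b<c 1F 2F _ = b<c
strictlyIncreasing₃ a<b b<c 1F 1F (s≤s ())
strictlyIncreasing₃ a<b b<c 2F 1F (s≤s ())
strictlyIncreasing₃ a<b b<c 2F 2F (s≤s (s≤s ()))

both : ∀ {A B : Set} → A → B → A ⇔ B
both a b = mk⇔ (λ _ → b) (λ _ → a)

neither : ∀ {A B : Set} → ¬ A → ¬ B → A ⇔ B
neither ¬a ¬b = mk⇔ (⊥-elim ∘ ¬a) (⊥-elim ∘ ¬b)

orderIsomorphic-123 : ∀ {x y z : Fin n} → x Fin.< y → y Fin.< z →
                      OrderIsomorphic (x ∷ y ∷ z ∷ []) perm123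
orderIsomorphic-123 {x = x} {y} {z} x<y y<z = iso
  where
  x<z = ℕ.<-trans x<y y<z

  iso : OrderIsomorphic (x ∷ y ∷ z ∷ []) perm123
  iso 0F 0F = neither (ℕ.<-irrefl refl) λ ()
  iso 0F 1F = both x<y (s≤s z≤n)
  iso 0F 2F = both x<z (s≤s z≤n)
  iso 1F 0F = neither (ℕ.<-asym x<y) λ ()
  iso 1F 1F = neither (ℕ.<-irrefl refl) (ℕ.<-irrefl refl)
  iso 1F 2F = both y<z (s≤s (s≤s z≤n))
  iso 2F 0F = neither (ℕ.<-asym x<z) λ ()
  iso 2F 1F = neither (ℕ.<-asym y<z) λ { (s≤s ()) }
  iso 2F 2F = neither (ℕ.<-irrefl refl) (ℕ.<-irrefl refl)

orderIsomorphic-132 : ∀ {x y z : Fin n} → x Fin.< z → z Fin.< y →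
                      OrderIsomorphic (x ∷ y ∷ z ∷ []) perm132
orderIsomorphic-132 {x = x} {y} {z} x<z z<y = iso
  where
  x<y = ℕ.<-trans x<z z<y

  iso : OrderIsomorphic (x ∷ y ∷ z ∷ []) perm132
  iso 0F 0F = neither (ℕ.<-irrefl refl) λ ()
  iso 0F 1F = both x<y (s≤s z≤n)
  iso 0F 2F = both x<z (s≤s z≤n)
  iso 1F 0F = neither (ℕ.<-asym x<y) λ ()
  iso 1F 1F = neither (ℕ.<-irrefl refl) (ℕ.<-irrefl refl)
  iso 1F 2F = neither (ℕ.<-asym z<y) λ { (s≤s ()) }
  iso 2F 0F = neither (ℕ.<-asym x<z) λ ()
  iso 2F 1F = both z<y (s≤s (s≤s z≤n))
  iso 2F 2F = neither (ℕ.<-irrefl refl) (ℕ.<-irrefl refl)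

members : ∀ (w : Vec (Fin k) N) x y z (j : Fin 3) →
          lookup (x ∷ y ∷ z ∷ []) j ∈ˢ
          lookup (blocks w) (lookup (lookup w x ∷ lookup w y ∷ lookup w z ∷ []) j)
members w x y z 0F = ∈-blocks⁺ w refl
members w x y z 1F = ∈-blocks⁺ w refl
members w x y z 2F = ∈-blocks⁺ w refl

-- Positions of the word are the elements and letters are the block indices, so an occurrence of 123
-- is an increasing triple of positions carrying increasing letters.
avoids-123⇔ : ∀ (w : Vec (Fin k) N) → Avoids perm123 (blocks w) ⇔ Avoidance.AvoidsTriples Fin._<_ w
avoids-123⇔ w = mk⇔
  (λ avoids h i j h<i i<j wh<wi _ wi<wj → avoids
    ( lookup w h ∷ lookup w i ∷ lookup w j ∷ [] , strictlyIncreasing₃ wh<wi wi<wj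
    , h ∷ i ∷ j ∷ [] , members w h i j , orderIsomorphic-123 h<i i<j))
  (λ { triples (is , inc , x ∷ y ∷ z ∷ [] , mem , iso) →
    let wx = ∈-blocks⁻ w (mem 0F)
        wy = ∈-blocks⁻ w (mem 1F)
        wz = ∈-blocks⁻ w (mem 2F)
    in triples x y z
      (Equivalence.from (iso 0F 1F) (s≤s z≤n))
      (Equivalence.from (iso 1F 2F) (s≤s (s≤s z≤n)))
      (subst₂ Fin._<_ (sym wx) (sym wy) (inc 0F 1F (s≤s z≤n)))
      (subst₂ Fin._<_ (sym wx) (sym wz) (inc 0F 2F (s≤s z≤n)))
      (subst₂ Fin._<_ (sym wy) (sym wz) (inc 1F 2F (s≤s (s≤s z≤n)))) })

-- Listed by block index, the elements of an occurrence are smallest, largest, middle. Listed by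
-- position, the last two are swapped, so their letters decrease; hence the flipped order and the
-- exchange of `i` and `j`.
avoids-132⇔ : ∀ (w : Vec (Fin k) N) →
              Avoids perm132 (blocks w) ⇔ Avoidance.AvoidsTriples (flip Fin._<_) w
avoids-132⇔ w = mk⇔
  (λ avoids h i j h<i i<j _ wh<wj wj<wi → avoids
    ( lookup w h ∷ lookup w j ∷ lookup w i ∷ [] , strictlyIncreasing₃ wh<wj wj<wi
    , h ∷ j ∷ i ∷ [] , members w h j i , orderIsomorphic-132 h<i i<j))
  (λ { triples (is , inc , x ∷ y ∷ z ∷ [] , mem , iso) →
    let wx = ∈-blocks⁻ w (mem 0F)
        wy = ∈-blocks⁻ w (mem 1F)
        wz = ∈-blocks⁻ w (mem 2F)
    in triples x z y
      (Equivalence.from (iso 0F 2F) (s≤s z≤n))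
      (Equivalence.from (iso 2F 1F) (s≤s (s≤s z≤n)))
      (subst₂ Fin._<_ (sym wx) (sym wz) (inc 0F 2F (s≤s z≤n)))
      (subst₂ Fin._<_ (sym wx) (sym wy) (inc 0F 1F (s≤s z≤n)))
      (subst₂ Fin._<_ (sym wy) (sym wz) (inc 1F 2F (s≤s (s≤s z≤n)))) })

theorem7 : ∀ (k : ℕ) (b : Vec ℕ k) → (∀ (i : Fin k) → 0 < lookup b i) →
    op b perm123 ≡ op b perm132
theorem7 k b 0<b = begin
  op b perm123                  ≡⟨ op≡completions <-sto perm123 avoids-123⇔ b 0<b ⟩
  -- Both counts start from the same multiplicities `b` at threshold `k`, so agreement is trivial.
  C<.completions (sum b) k b    ≡⟨ completions-independent <-sto >-sto (sum b) k b b refl refl (λ _ _ → refl) ⟩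
  C>.completions (sum b) k b    ≡⟨ op≡completions >-sto perm132 avoids-132⇔ b 0<b ⟨
  op b perm132                  ∎
  where
  open ≡-Reasoning
  <-sto = Fin.<-isStrictTotalOrder {k}
  >-sto = flip-isStrictTotalOrder <-sto
  module C< = AvoiderCount <-sto
  module C> = AvoiderCount >-sto
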